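{- For every integer $l \ge 1$, the resolving domination number of the fractal cubic network $FCN(l)$ satisfies $\gamma_r(FCN(l)) = 4\,\gamma_2(FCN(l-1))$, where $\gamma_2$ denotes the 2-domination number.
   Context: Fractal cubic network: for an integer $l\ge 0$, $FCN(l)$ is the finite simple graph whose vertices are all binary strings of length $2l+2$, defined recursively as follows. $FCN(0)$ is the 4-cycle with vertices $00, 01, 11, 10$ in this cyclic order. For $l\ge 1$, $FCN(l)$ is obtained from the disjoint union of the four copies $ab\,\Vert\,FCN(l-1)$, $a,b\in\{0,1\}$ (each vertex string of $FCN(l-1)$ is prefixed by $ab$, adjacency inside a copy being that of $FCN(l-1)$), by adding the four edges $\{00w,10w\}$, $\{10w,11w\}$, $\{11w,01w\}$, $\{01w,00w\}$, where $w=10(01)^{l-1}$ is the string $10$ followed by $l-1$ repetitions of $01$. A set $R\subseteq V(\Gamma)$ of a connected graph $\Gamma$ is a resolving set if for every two distinct vertices $g,h$ there is $r\in R$ with $d(g,r)\ne d(h,r)$ (graph distance). A dominating set is a set $D\subseteq V(\Gamma)$ such that every vertex is in $D$ or adjacent to a vertex of $D$. A resolving dominating set is a set that is both resolving and dominating; $\gamma_r(\Gamma)$ is the minimum size of such a set. A 2-dominating set is a set $D$ such that every $v\in V(\Gamma)\setminus D$ has at least two neighbors in $D$; $\gamma_2(\Gamma)$ is the minimum size of a 2-dominating set. -}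

module Defs where

open import Data.Bool.Base using (Bool; true; false)
open import Data.Empty using (⊥)
open import Data.List.Base using (List; []; _∷_; length; cartesianProductWith)
open import Data.List.Membership.Propositional using (_∈_; _∉_)
open import Data.List.Membership.Propositional.Properties
  using (∈-cartesianProductWith⁺)
open import Data.List.Relation.Unary.Any using (here; there)
open import Data.List.Relation.Unary.Unique.Propositional using (Unique)
open import Data.Nat.Base using (ℕ; zero; suc; _+_; _*_; _≤_)
open import Data.Nat.Properties using (≤-antisym)
open import Data.Product.Base using (_×_; _,_; ∃-syntax)
open import Data.Sum.Base using (_⊎_; inj₁; inj₂)
open import Data.Vec.Base using (Vec; []; _∷_; concat; replicate)
open import Level using (0ℓ)
open import Relation.Binary.Construct.Closure.Symmetric
  using (SymClosure; fwd; bwd; symmetric)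
open import Relation.Binary.Core using (Rel)
open import Relation.Binary.Definitions using (Symmetric; Irreflexive)
open import Relation.Binary.PropositionalEquality.Core
  using (_≡_; _≢_; refl; sym; subst)

record FiniteSimpleGraph : Set₁ where
  infix 4 _~_
  field
    V        : Set
    _~_      : Rel V 0ℓ
    ~-sym    : Symmetric _~_
    ~-irrefl : Irreflexive _≡_ _~_
    vertices : List V
    complete : ∀ v → v ∈ vertices

-- A set of vertices is a list, and its size is the length of that list provided
-- the list is duplicate-free; `IsMinimumSize` imposes the latter condition.

IsMinimumSize : {A : Set} → (List A → Set) → ℕ → Set
IsMinimumSize P n =
    (∃[ D ] Unique D × P D × length D ≡ n)
  × (∀ D → Unique D → P D → n ≤ length D)

minimumSize-unique : {A : Set} {P : List A → Set} {m n : ℕ} →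
                     IsMinimumSize P m → IsMinimumSize P n → m ≡ n
minimumSize-unique {m = m} {n} ((D , uD , pD , ∣D∣≡m) , minₘ) ((E , uE , pE , ∣E∣≡n) , minₙ) =
  ≤-antisym (subst (m ≤_) ∣E∣≡n (minₘ E uE pE)) (subst (n ≤_) ∣D∣≡m (minₙ D uD pD))

module _ (Γ : FiniteSimpleGraph) where
  open FiniteSimpleGraph Γ

  data Walk : V → V → ℕ → Set where
    nil  : ∀ {u} → Walk u u 0
    step : ∀ {u v w n} → u ~ v → Walk v w n → Walk u w (suc n)

  Distance : V → V → ℕ → Set
  Distance u v n = Walk u v n × (∀ m → Walk u v m → n ≤ m)

  -- Asks that both distances exist, which is automatic in a connected graph.
  Resolves : V → V → V → Set
  Resolves r g h = ∃[ m ] ∃[ n ] Distance g r m × Distance h r n × m ≢ n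

  Resolving : List V → Set
  Resolving R = ∀ g h → g ≢ h → ∃[ r ] r ∈ R × Resolves r g h

  Dominating : List V → Set
  Dominating D = ∀ v → v ∈ D ⊎ (∃[ u ] u ∈ D × v ~ u)

  ResolvingDominating : List V → Set
  ResolvingDominating D = Resolving D × Dominating D

  TwoDominating : List V → Set
  TwoDominating D =
    ∀ v → v ∉ D → ∃[ x ] ∃[ y ] x ≢ y × (x ∈ D × v ~ x) × (y ∈ D × v ~ y)

  IsResolvingDominationNumber : ℕ → Set
  IsResolvingDominationNumber = IsMinimumSize ResolvingDominating

  Is2DominationNumber : ℕ → Set
  Is2DominationNumber = IsMinimumSize TwoDominating

pattern 𝟎 = false
pattern 𝟏 = true

-- The 4-cycle 00, 01, 11, 10. It serves both as FCN(0) and as the pattern of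
-- the four edges joining the copies.

data Side : Rel (Bool × Bool) 0ℓ where
  00–01 : Side (𝟎 , 𝟎) (𝟎 , 𝟏)
  01–11 : Side (𝟎 , 𝟏) (𝟏 , 𝟏)
  11–10 : Side (𝟏 , 𝟏) (𝟏 , 𝟎)
  10–00 : Side (𝟏 , 𝟎) (𝟎 , 𝟎)

Square : Rel (Bool × Bool) 0ℓ
Square = SymClosure Side

String : ℕ → Set
String l = Vec Bool (2 + l * 2)

-- The string 10(01)ᵏ, so that FCN(l) for l ≥ 1 uses `link (l - 1)`.
link : ∀ k → String k
link k = 𝟏 ∷ 𝟎 ∷ concat (replicate k (𝟎 ∷ 𝟏 ∷ []))

Adjacent : ∀ l → Rel (String l) 0ℓ
Adjacent zero    (a ∷ b ∷ []) (c ∷ d ∷ []) = Square (a , b) (c , d)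
Adjacent (suc k) (a ∷ b ∷ u)  (c ∷ d ∷ v)  =
    ((a , b) ≡ (c , d) × Adjacent k u v)
  ⊎ (Square (a , b) (c , d) × u ≡ link k × v ≡ link k)

Square-irrefl : ∀ {p} → Square p p → ⊥
Square-irrefl (fwd ())
Square-irrefl (bwd ())

Adjacent-sym : ∀ l → Symmetric (Adjacent l)
Adjacent-sym zero    {_ ∷ _ ∷ []} {_ ∷ _ ∷ []} s = symmetric Side s
Adjacent-sym (suc k) {_ ∷ _ ∷ _} {_ ∷ _ ∷ _} (inj₁ (p , e)) =
  inj₁ (sym p , Adjacent-sym k e)
Adjacent-sym (suc k) {_ ∷ _ ∷ _} {_ ∷ _ ∷ _} (inj₂ (s , p , q)) =
  inj₂ (symmetric Side s , q , p)

Adjacent-irrefl : ∀ l → Irreflexive _≡_ (Adjacent l)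
Adjacent-irrefl zero    {_ ∷ _ ∷ []} refl s              = Square-irrefl s
Adjacent-irrefl (suc k) {_ ∷ _ ∷ _}  refl (inj₁ (_ , e)) = Adjacent-irrefl k refl e
Adjacent-irrefl (suc k) {_ ∷ _ ∷ _}  refl (inj₂ (s , _)) = Square-irrefl s

bits : List Bool
bits = 𝟎 ∷ 𝟏 ∷ []

∈-bits : ∀ b → b ∈ bits
∈-bits 𝟎 = here refl
∈-bits 𝟏 = there (here refl)

allStrings : ∀ n → List (Vec Bool n)
allStrings zero    = [] ∷ []
allStrings (suc n) = cartesianProductWith _∷_ bits (allStrings n)

∈-allStrings : ∀ {n} (v : Vec Bool n) → v ∈ allStrings n
∈-allStrings []      = here refl
∈-allStrings (b ∷ v) = ∈-cartesianProductWith⁺ _∷_ (∈-bits b) (∈-allStrings v)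

FCN : ℕ → FiniteSimpleGraph
FCN l = record
  { V        = String l
  ; _~_      = Adjacent l
  ; ~-sym    = Adjacent-sym l
  ; ~-irrefl = Adjacent-irrefl l
  ; vertices = allStrings (2 + l * 2)
  ; complete = ∈-allStrings
  }

-- FCN(l) is a cactus of 4-cycles: two distinct copies of FCN(l-1) inside FCN(l)
-- are joined only through their link vertices.  In each of the 4^l cells
-- x∥FCN(0), the vertices x00 and x11 are never links, so they are twins: both
-- have exactly the neighbours x01 and x10.
--
-- A set that resolves contains x00 or x11, and to dominate the other of the two
-- it needs a second vertex of the cell; a 2-dominating set contains x00 and x11,
-- or else x01 and x10.  Either way every cell contributes at least two vertices.
-- Conversely, the set of all the vertices x00 and x11 is 2-dominating, and it is
-- resolving as soon as l ≥ 1: only x01 and x10 need an argument, and they are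
-- told apart by a cell adjacent to x10.
{-# OPTIONS --safe #-}
module Submission where

open import Defs
open import Data.Bool.Base using (Bool; not)
open import Data.Bool.Properties using () renaming (_≟_ to _≟ᵇ_)
open import Data.Empty using (⊥-elim)
open import Data.List.Base using (List; []; _∷_; length; map; cartesianProductWith)
open import Data.List.Membership.Propositional using (_∈_; _∉_)
open import Data.List.Membership.DecPropositional using (_∈?_)
open import Data.List.Membership.Propositional.Properties
  using (∈-cartesianProductWith⁺; ∈-cartesianProductWith⁻)
open import Data.List.Properties using (length-++; length-map)
open import Data.List.Relation.Unary.All using ([]; _∷_)
open import Data.List.Relation.Unary.AllPairs using ([]; _∷_)
open import Data.List.Relation.Unary.Any using (here; there)
open import Data.List.Relation.Unary.Unique.Propositional using (Unique)
open import Data.List.Relation.Unary.Unique.Propositional.Properties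
  using (cartesianProductWith⁺)
open import Data.Nat.Base using (ℕ; zero; suc; _+_; _*_; _∸_; _≤_; _≥_; z≤n; s≤s)
open import Data.Nat.Properties
open import Data.Product.Base using (_×_; _,_; ∃-syntax)
open import Data.Sum.Base using (_⊎_; inj₁; inj₂; [_,_]′)
open import Data.Vec.Base using (Vec; []; _∷_; concat; replicate)
open import Data.Vec.Properties using (∷-injective; ≡-dec)
open import Function.Base using (_∘_)
open import Relation.Binary.Construct.Closure.Symmetric using (fwd; bwd)
open import Relation.Binary.PropositionalEquality.Core
  using (_≡_; _≢_; refl; sym; trans; cong; cong₂; subst)
open import Relation.Binary.PropositionalEquality.Properties using (module ≡-Reasoning)
open import Relation.Nullary using (yes; no; contradiction)

-- Walks and twins in an arbitrary graph

module _ {Γ : FiniteSimpleGraph} where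
  open FiniteSimpleGraph Γ

  _++ʷ_ : ∀ {u v w m n} → Walk Γ u v m → Walk Γ v w n → Walk Γ u w (m + n)
  nil      ++ʷ q = q
  step e p ++ʷ q = step e (p ++ʷ q)

  walk-zero : ∀ {u v} → Walk Γ u v 0 → u ≡ v
  walk-zero nil = refl

  twin-walk : ∀ {u v r n} → (∀ {w} → u ~ w → v ~ w) →
              Walk Γ u r (suc n) → Walk Γ v r (suc n)
  twin-walk N (step e p) = step (N e) p

  -- A walk of positive length begins with an edge, and that edge can start at the other twin
  -- instead. So two positive distances to `r` are equal, and `r` can only tell the twins apart by
  -- being one of them.
  twins-resolved : ∀ {u v r} → (∀ {w} → u ~ w → v ~ w) → (∀ {w} → v ~ w → u ~ w) →
                   Resolves Γ r u v → r ≡ u ⊎ r ≡ v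
  twins-resolved _ _ (zero , _ , (p , _) , _) = inj₁ (sym (walk-zero p))
  twins-resolved _ _ (suc _ , zero , _ , (q , _) , _) = inj₂ (sym (walk-zero q))
  twins-resolved N M (suc _ , suc _ , (p , p-min) , (q , q-min) , m≢n) =
    contradiction (≤-antisym (p-min _ (twin-walk M q)) (q-min _ (twin-walk N p))) m≢n

module _ {Γ Δ : FiniteSimpleGraph} where
  private
    module Γ = FiniteSimpleGraph Γ
    module Δ = FiniteSimpleGraph Δ

  mapʷ : (f : Γ.V → Δ.V) → (∀ {u v} → u Γ.~ v → f u Δ.~ f v) →
         ∀ {u v n} → Walk Γ u v n → Walk Δ (f u) (f v) n
  mapʷ f hom nil        = nil
  mapʷ f hom (step e p) = step (hom e) (mapʷ f hom p)

-- Distances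

bitDist : Bool → Bool → ℕ
bitDist 𝟎 𝟎 = 0
bitDist 𝟎 𝟏 = 1
bitDist 𝟏 𝟎 = 1
bitDist 𝟏 𝟏 = 0

-- The edges of the 4-cycle flip one bit each, so its metric is the Hamming distance.
squareDist : String 0 → String 0 → ℕ
squareDist (a ∷ b ∷ []) (c ∷ d ∷ []) = bitDist a c + bitDist b d

-- Arguments: the number of link edges between two copies, the distance of the
-- vertices if the copies coincide, and the distance of each vertex to its link.
join : ℕ → ℕ → ℕ → ℕ → ℕ
join zero    same _ _ = same
join (suc h) _    p q = p + (suc h + q)

-- Walks between different copies leave and enter through link vertices, and the four links form a
-- 4-cycle. A detour through other copies never shortens a walk with both ends in one copy.
dist : ∀ l → String l → String l → ℕ
dist zero    u v = squareDist u v
dist (suc k) (a ∷ b ∷ u) (c ∷ d ∷ v) =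
  join (squareDist (a ∷ b ∷ []) (c ∷ d ∷ [])) (dist k u v) (dist k u (link k)) (dist k (link k) v)

bitDist-refl : ∀ a → bitDist a a ≡ 0
bitDist-refl 𝟎 = refl
bitDist-refl 𝟏 = refl

squareDist-refl : ∀ p → squareDist p p ≡ 0
squareDist-refl (a ∷ b ∷ []) = cong₂ _+_ (bitDist-refl a) (bitDist-refl b)

dist-refl : ∀ l u → dist l u u ≡ 0
dist-refl zero u = squareDist-refl u
dist-refl (suc k) (a ∷ b ∷ u) rewrite squareDist-refl (a ∷ b ∷ []) = dist-refl k u

square-walk : ∀ p q → Walk (FCN 0) p q (squareDist p q)
square-walk (a ∷ b ∷ []) (c ∷ d ∷ []) = first a c b ++ʷ second c b d
  where
  first : ∀ a c b → Walk (FCN 0) (a ∷ b ∷ []) (c ∷ b ∷ []) (bitDist a c)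
  first 𝟎 𝟎 b = nil
  first 𝟎 𝟏 𝟎 = step (bwd 10–00) nil
  first 𝟎 𝟏 𝟏 = step (fwd 01–11) nil
  first 𝟏 𝟎 𝟎 = step (fwd 10–00) nil
  first 𝟏 𝟎 𝟏 = step (bwd 01–11) nil
  first 𝟏 𝟏 b = nil

  second : ∀ c b d → Walk (FCN 0) (c ∷ b ∷ []) (c ∷ d ∷ []) (bitDist b d)
  second c 𝟎 𝟎 = nil
  second 𝟎 𝟎 𝟏 = step (fwd 00–01) nil
  second 𝟏 𝟎 𝟏 = step (bwd 11–10) nil
  second 𝟎 𝟏 𝟎 = step (bwd 00–01) nil
  second 𝟏 𝟏 𝟎 = step (fwd 11–10) nil
  second c 𝟏 𝟏 = nil

linked : ∀ k → String 0 → String (suc k)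
linked k (a ∷ b ∷ []) = a ∷ b ∷ link k

linked-hom : ∀ k {p q} → Adjacent 0 p q → Adjacent (suc k) (linked k p) (linked k q)
linked-hom k {_ ∷ _ ∷ []} {_ ∷ _ ∷ []} s = inj₂ (s , refl , refl)

shortest-walk : ∀ l u v → Walk (FCN l) u v (dist l u v)
shortest-walk zero u v = square-walk u v
shortest-walk (suc k) (a ∷ b ∷ u) (c ∷ d ∷ v) = via (square-walk (a ∷ b ∷ []) (c ∷ d ∷ []))
  where
  inCopy : ∀ a b {u v n} → Walk (FCN k) u v n → Walk (FCN (suc k)) (a ∷ b ∷ u) (a ∷ b ∷ v) n
  inCopy a b = mapʷ (λ u → a ∷ b ∷ u) (λ e → inj₁ (refl , e))

  -- With the length generalised to `h`, matching on the walk decides which branch of `join`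
  -- applies, and `nil` also identifies the two prefixes.
  via : ∀ {h} → Walk (FCN 0) (a ∷ b ∷ []) (c ∷ d ∷ []) h →
        Walk (FCN (suc k)) (a ∷ b ∷ u) (c ∷ d ∷ v)
          (join h (dist k u v) (dist k u (link k)) (dist k (link k) v))
  via nil = inCopy a b (shortest-walk k u v)
  via p@(step _ _) = inCopy a b (shortest-walk k u (link k))
    ++ʷ (mapʷ (linked k) (linked-hom k) p ++ʷ inCopy c d (shortest-walk k (link k) v))

-- When the starting vertex is a link, the two branches of `join` agree. Hence crossing a link edge
-- changes a distance only through `h`, even when it enters or leaves the target copy.
join-at-link : ∀ h q → join h q 0 q ≡ h + q
join-at-link zero    q = refl
join-at-link (suc h) q = refl

join-mono : ∀ h {s s′ p p′} q → s ≤ suc s′ → p ≤ suc p′ → join h s p q ≤ suc (join h s′ p′ q)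
join-mono zero    q s≤ p≤ = s≤
join-mono (suc h) q s≤ p≤ = +-monoˡ-≤ (suc h + q) p≤

bitDist-≤1 : ∀ a b → bitDist a b ≤ 1
bitDist-≤1 𝟎 𝟎 = z≤n
bitDist-≤1 𝟎 𝟏 = ≤-refl
bitDist-≤1 𝟏 𝟎 = ≤-refl
bitDist-≤1 𝟏 𝟏 = z≤n

squareDist-step : ∀ p q r → Adjacent 0 p q → squareDist p r ≤ suc (squareDist q r)
squareDist-step (a ∷ b ∷ []) (c ∷ d ∷ []) (e ∷ f ∷ []) = λ where
    (fwd 00–01) → second 𝟎 𝟎 𝟏
    (bwd 00–01) → second 𝟎 𝟏 𝟎
    (fwd 01–11) → first 𝟎 𝟏 𝟏
    (bwd 01–11) → first 𝟏 𝟎 𝟏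
    (fwd 11–10) → second 𝟏 𝟏 𝟎
    (bwd 11–10) → second 𝟏 𝟎 𝟏
    (fwd 10–00) → first 𝟏 𝟎 𝟎
    (bwd 10–00) → first 𝟎 𝟏 𝟎
  where
  first : ∀ a c b → bitDist a e + bitDist b f ≤ suc (bitDist c e + bitDist b f)
  first a c b = +-monoˡ-≤ (bitDist b f) (≤-trans (bitDist-≤1 a e) (s≤s z≤n))

  second : ∀ a b d → bitDist a e + bitDist b f ≤ suc (bitDist a e + bitDist d f)
  second a b d = ≤-trans
    (+-monoʳ-≤ (bitDist a e) (≤-trans (bitDist-≤1 b f) (s≤s z≤n)))
    (≤-reflexive (+-suc (bitDist a e) (bitDist d f)))

-- An edge inside a copy affects only the second and third arguments of `join`, a link edge only the
-- first. Summed along a walk, this bounds its length from below by `dist`.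
dist-step : ∀ l u v r → Adjacent l u v → dist l u r ≤ suc (dist l v r)
dist-step zero u v r e = squareDist-step u v r e
dist-step (suc k) (a ∷ b ∷ u) (_ ∷ _ ∷ v) (c ∷ d ∷ r) (inj₁ (refl , e)) =
  join-mono (squareDist (a ∷ b ∷ []) (c ∷ d ∷ [])) (dist k (link k) r)
    (dist-step k u v r e) (dist-step k u v (link k) e)
dist-step (suc k) (a ∷ b ∷ _) (a′ ∷ b′ ∷ _) (c ∷ d ∷ r) (inj₂ (s , refl , refl))
  rewrite dist-refl k (link k)
        | join-at-link (squareDist (a ∷ b ∷ []) (c ∷ d ∷ [])) (dist k (link k) r)
        | join-at-link (squareDist (a′ ∷ b′ ∷ []) (c ∷ d ∷ [])) (dist k (link k) r)
  = +-monoˡ-≤ (dist k (link k) r) (squareDist-step (a ∷ b ∷ []) (a′ ∷ b′ ∷ []) (c ∷ d ∷ []) s)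

dist-minimal : ∀ l {u v m} → Walk (FCN l) u v m → dist l u v ≤ m
dist-minimal l {u} nil = ≤-reflexive (dist-refl l u)
dist-minimal l (step e p) = ≤-trans (dist-step l _ _ _ e) (s≤s (dist-minimal l p))

distance : ∀ l u v → Distance (FCN l) u v (dist l u v)
distance l u v = shortest-walk l u v , λ _ → dist-minimal l

dist≢0 : ∀ l {u v} → u ≢ v → dist l u v ≢ 0
dist≢0 l {u} {v} u≢v d≡0 = u≢v (walk-zero (subst (Walk (FCN l) u v) d≡0 (shortest-walk l u v)))

resolves : ∀ l {r g h} → dist l g r ≢ dist l h r → Resolves (FCN l) r g h
resolves l {r} {g} {h} d≢ = dist l g r , dist l h r , distance l g r , distance l h r , d≢

-- Cells

-- Recursion instead of concatenation keeps the length in the form `2 + l * 2`, without transport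
-- along an equation.
place : ∀ l → Vec Bool (l * 2) → String 0 → String l
place zero    []          p = p
place (suc k) (a ∷ b ∷ x) p = a ∷ b ∷ place k x p

corner : ∀ l → String l → String 0
corner zero    v           = v
corner (suc k) (_ ∷ _ ∷ v) = corner k v

placed : ∀ l v → ∃[ x ] v ≡ place l x (corner l v)
placed zero    v = [] , refl
placed (suc k) (a ∷ b ∷ v) with placed k v
... | x , eq = a ∷ b ∷ x , cong (λ w → a ∷ b ∷ w) eq

corner-place : ∀ l x p → corner l (place l x p) ≡ p
corner-place zero    []          p = refl
corner-place (suc k) (_ ∷ _ ∷ x) p = corner-place k x p

place-injective : ∀ l x {p q} → place l x p ≡ place l x q → p ≡ q
place-injective l x {p} {q} eq =
  trans (sym (corner-place l x p)) (trans (cong (corner l) eq) (corner-place l x q))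

place-adjacent : ∀ l x {p q} → Adjacent 0 p q → Adjacent l (place l x p) (place l x q)
place-adjacent zero    []          e = e
place-adjacent (suc k) (_ ∷ _ ∷ x) e = inj₁ (refl , place-adjacent k x e)

twinCorners : List (String 0)
twinCorners = (𝟎 ∷ 𝟎 ∷ []) ∷ (𝟏 ∷ 𝟏 ∷ []) ∷ []

-- A link ends in 10 if `k` is zero and in 01 otherwise.
link-corner : ∀ k → corner k (link k) ∉ twinCorners
link-corner zero    (there (there ()))
link-corner (suc k) = λ c∈ → 01∉ (subst (_∈ twinCorners) (last k) c∈)
  where
  01∉ : (𝟎 ∷ 𝟏 ∷ []) ∉ twinCorners
  01∉ (there (there ()))

  last : ∀ k → corner k (𝟎 ∷ 𝟏 ∷ concat (replicate k (𝟎 ∷ 𝟏 ∷ []))) ≡ 𝟎 ∷ 𝟏 ∷ []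
  last zero    = refl
  last (suc k) = last k

-- Both ends of an edge between copies are links, so by `link-corner` no such edge meets a twin, at
-- any level of the recursion.
twin-neighbour : ∀ l x {p v} → p ∈ twinCorners → Adjacent l (place l x p) v →
                 ∃[ q ] v ≡ place l x q × Adjacent 0 p q
twin-neighbour zero [] _ e = _ , refl , e
twin-neighbour (suc k) (_ ∷ _ ∷ x) {v = _ ∷ _ ∷ v} p∈ (inj₁ (refl , e))
  with q , refl , e′ ← twin-neighbour k x p∈ e = q , refl , e′
twin-neighbour (suc k) (_ ∷ _ ∷ x) {p} {_ ∷ _ ∷ _} p∈ (inj₂ (_ , eq , _)) =
  ⊥-elim (link-corner k
    (subst (_∈ twinCorners) (trans (sym (corner-place k x p)) (cong (corner k) eq)) p∈))

square-twins : ∀ {p q r} → p ∈ twinCorners → q ∈ twinCorners → Adjacent 0 p r → Adjacent 0 q r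
square-twins (here refl) (here refl) e = e
square-twins (there (here refl)) (there (here refl)) e = e
square-twins {r = 𝟎 ∷ 𝟏 ∷ []} (here refl) (there (here refl)) _ = bwd 01–11
square-twins {r = 𝟏 ∷ 𝟎 ∷ []} (here refl) (there (here refl)) _ = fwd 11–10
square-twins {r = 𝟎 ∷ 𝟎 ∷ []} (here refl) (there (here refl)) (fwd ())
square-twins {r = 𝟎 ∷ 𝟎 ∷ []} (here refl) (there (here refl)) (bwd ())
square-twins {r = 𝟏 ∷ 𝟏 ∷ []} (here refl) (there (here refl)) (fwd ())
square-twins {r = 𝟏 ∷ 𝟏 ∷ []} (here refl) (there (here refl)) (bwd ())
square-twins {r = 𝟎 ∷ 𝟏 ∷ []} (there (here refl)) (here refl) _ = fwd 00–01
square-twins {r = 𝟏 ∷ 𝟎 ∷ []} (there (here refl)) (here refl) _ = bwd 10–00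
square-twins {r = 𝟎 ∷ 𝟎 ∷ []} (there (here refl)) (here refl) (fwd ())
square-twins {r = 𝟎 ∷ 𝟎 ∷ []} (there (here refl)) (here refl) (bwd ())
square-twins {r = 𝟏 ∷ 𝟏 ∷ []} (there (here refl)) (here refl) (fwd ())
square-twins {r = 𝟏 ∷ 𝟏 ∷ []} (there (here refl)) (here refl) (bwd ())

twins : ∀ l x {p q} → p ∈ twinCorners → q ∈ twinCorners →
        ∀ {w} → Adjacent l (place l x p) w → Adjacent l (place l x q) w
twins l x p∈ q∈ e with r , refl , e′ ← twin-neighbour l x p∈ e =
  place-adjacent l x (square-twins p∈ q∈ e′)

-- Lower bound

TwoInCell : ∀ l → List (String l) → Vec Bool (l * 2) → Set
TwoInCell l D x = ∃[ p ] ∃[ q ] p ≢ q × place l x p ∈ D × place l x q ∈ D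

TwoPerCell : ∀ l → List (String l) → Set
TwoPerCell l D = ∀ x → TwoInCell l D x

resolvingDominating⇒twoPerCell : ∀ l {D} → ResolvingDominating (FCN l) D → TwoPerCell l D
resolvingDominating⇒twoPerCell l {D} (resolving , dominating) x =
  [ withTwin (λ ()) 00∈ 11∈ , withTwin (λ ()) 11∈ 00∈ ]′ oneTwin
  where
  00∈ = here refl
  11∈ = there (here refl)

  oneTwin : place l x (𝟎 ∷ 𝟎 ∷ []) ∈ D ⊎ place l x (𝟏 ∷ 𝟏 ∷ []) ∈ D
  oneTwin with resolving (place l x (𝟎 ∷ 𝟎 ∷ [])) (place l x (𝟏 ∷ 𝟏 ∷ []))
                 (λ eq → contradiction (place-injective l x eq) λ ())
  ... | r , r∈ , res
    with twins-resolved {FCN l} (twins l x 00∈ 11∈) (twins l x 11∈ 00∈) res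
  ...   | inj₁ refl = inj₁ r∈
  ...   | inj₂ refl = inj₂ r∈

  withTwin : ∀ {p q} → p ≢ q → p ∈ twinCorners → q ∈ twinCorners → place l x p ∈ D →
             TwoInCell l D x
  withTwin {p} {q} p≢q p∈ q∈ p∈D with dominating (place l x q)
  ... | inj₁ q∈D = p , q , p≢q , p∈D , q∈D
  ... | inj₂ (u , u∈D , q~u) with r , refl , q~r ← twin-neighbour l x q∈ q~u =
    -- The dominating neighbour `r` of `q` is also a neighbour of its twin `p`, hence different from
    -- `p`.
    p , r , (λ p≡r → Adjacent-irrefl 0 p≡r (square-twins q∈ p∈ q~r)) , p∈D , u∈D

twoDominating⇒twoPerCell : ∀ l {D} → TwoDominating (FCN l) D → TwoPerCell l D
twoDominating⇒twoPerCell l {D} dominating x =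
  missingOr (here refl) λ 00∈D →
  missingOr (there (here refl)) λ 11∈D →
  𝟎 ∷ 𝟎 ∷ [] , 𝟏 ∷ 𝟏 ∷ [] , (λ ()) , 00∈D , 11∈D
  where
  -- A twin outside `D` has two neighbours in `D`, both in its own cell; otherwise the argument
  -- continues with the twin in `D`.
  missingOr : ∀ {p} → p ∈ twinCorners → (place l x p ∈ D → TwoInCell l D x) → TwoInCell l D x
  missingOr {p} p∈ k with place l x p ∈ᵛ? D
    where _∈ᵛ?_ = _∈?_ (≡-dec _≟ᵇ_)
  ... | yes p∈D = k p∈D
  ... | no  p∉D with u , v , u≢v , (u∈D , p~u) , (v∈D , p~v) ← dominating _ p∉D
    with twin-neighbour l x p∈ p~u | twin-neighbour l x p∈ p~v
  ...   | q , refl , _ | r , refl , _ = q , r , (λ { refl → u≢v refl }) , u∈D , v∈D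

-- Counting the vertices over all cells

tails : ∀ {n} → Bool → List (Vec Bool (suc n)) → List (Vec Bool n)
tails b []            = []
tails 𝟎 ((𝟎 ∷ v) ∷ D) = v ∷ tails 𝟎 D
tails 𝟎 ((𝟏 ∷ v) ∷ D) = tails 𝟎 D
tails 𝟏 ((𝟎 ∷ v) ∷ D) = tails 𝟏 D
tails 𝟏 ((𝟏 ∷ v) ∷ D) = v ∷ tails 𝟏 D

∈-tails : ∀ {n} b {v : Vec Bool n} D → b ∷ v ∈ D → v ∈ tails b D
∈-tails 𝟎 (_ ∷ D)       (here refl) = here refl
∈-tails 𝟏 (_ ∷ D)       (here refl) = here refl
∈-tails 𝟎 ((𝟎 ∷ _) ∷ D) (there v∈)  = there (∈-tails 𝟎 D v∈)
∈-tails 𝟎 ((𝟏 ∷ _) ∷ D) (there v∈)  = ∈-tails 𝟎 D v∈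
∈-tails 𝟏 ((𝟎 ∷ _) ∷ D) (there v∈)  = ∈-tails 𝟏 D v∈
∈-tails 𝟏 ((𝟏 ∷ _) ∷ D) (there v∈)  = there (∈-tails 𝟏 D v∈)

length-tails : ∀ {n} (D : List (Vec Bool (suc n))) →
               length (tails 𝟎 D) + length (tails 𝟏 D) ≡ length D
length-tails []            = refl
length-tails ((𝟎 ∷ _) ∷ D) = cong suc (length-tails D)
length-tails ((𝟏 ∷ _) ∷ D) = trans (+-suc _ _) (cong suc (length-tails D))

double-≤-length : ∀ {n m} (D : List (Vec Bool (suc n))) →
                  (∀ b → m ≤ length (tails b D)) → 2 * m ≤ length D
double-≤-length {m = m} D m≤ = begin
  m + (m + 0)                             ≡⟨ cong (m +_) (+-identityʳ m) ⟩
  m + m                                   ≤⟨ +-mono-≤ (m≤ 𝟎) (m≤ 𝟏) ⟩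
  length (tails 𝟎 D) + length (tails 𝟏 D) ≡⟨ length-tails D ⟩
  length D                                ∎
  where open ≤-Reasoning

2*2*n≡4*n : ∀ n → 2 * (2 * n) ≡ 4 * n
2*2*n≡4*n n = sym (*-assoc 2 2 n)

-- This is twice the number of cells, that is, 2 times 4 to the power `l`.
size : ℕ → ℕ
size zero    = 2
size (suc l) = 4 * size l

2≤length : ∀ {A : Set} {x y : A} {D} → x ≢ y → x ∈ D → y ∈ D → 2 ≤ length D
2≤length x≢y (here refl)       (here refl)       = contradiction refl x≢y
2≤length x≢y (here refl)       (there (here _))  = s≤s (s≤s z≤n)
2≤length x≢y (here refl)       (there (there _)) = s≤s (s≤s z≤n)
2≤length x≢y (there (here _))  _                 = s≤s (s≤s z≤n)
2≤length x≢y (there (there _)) _                 = s≤s (s≤s z≤n)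

-- Splitting `D` by its first bit and then by its second isolates the part in each of the four
-- copies, where the induction hypothesis applies. Each split contributes a factor of 2.
twoPerCell-size : ∀ l {D} → TwoPerCell l D → size l ≤ length D
twoPerCell-size zero two with _ , _ , p≢q , p∈ , q∈ ← two [] = 2≤length p≢q p∈ q∈
twoPerCell-size (suc k) {D} two = subst (_≤ length D) (2*2*n≡4*n (size k))
  (double-≤-length D λ a → double-≤-length (tails a D) λ b → twoPerCell-size k (inCopy a b))
  where
  inCopy : ∀ a b → TwoPerCell k (tails b (tails a D))
  inCopy a b x with p , q , p≢q , p∈ , q∈ ← two (a ∷ b ∷ x) =
    p , q , p≢q , ∈-tails b _ (∈-tails a D p∈) , ∈-tails b _ (∈-tails a D q∈)

-- Upper bound

extend : ∀ {n} → List (Vec Bool n) → List (Vec Bool (suc n))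
extend = cartesianProductWith _∷_ bits

twinSet : ∀ l → List (String l)
twinSet zero    = twinCorners
twinSet (suc k) = extend (extend (twinSet k))

length-cartesianProductWith : ∀ {A B C : Set} (f : A → B → C) xs ys →
                              length (cartesianProductWith f xs ys) ≡ length xs * length ys
length-cartesianProductWith f []       ys = refl
length-cartesianProductWith f (x ∷ xs) ys = trans (length-++ (map (f x) ys))
  (cong₂ _+_ (length-map (f x) ys) (length-cartesianProductWith f xs ys))

length-extend : ∀ {n} (D : List (Vec Bool n)) → length (extend D) ≡ 2 * length D
length-extend = length-cartesianProductWith _∷_ bits

length-twinSet : ∀ l → length (twinSet l) ≡ size l
length-twinSet zero    = refl
length-twinSet (suc k) = begin
  length (extend (extend (twinSet k))) ≡⟨ length-extend (extend (twinSet k)) ⟩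
  2 * length (extend (twinSet k))      ≡⟨ cong (2 *_) (length-extend (twinSet k)) ⟩
  2 * (2 * length (twinSet k))         ≡⟨ 2*2*n≡4*n (length (twinSet k)) ⟩
  4 * length (twinSet k)               ≡⟨ cong (4 *_) (length-twinSet k) ⟩
  4 * size k                           ∎
  where open ≡-Reasoning

extend-unique : ∀ {n} {D : List (Vec Bool n)} → Unique D → Unique (extend D)
extend-unique = cartesianProductWith⁺ _∷_ ∷-injective (((λ ()) ∷ []) ∷ [] ∷ [])

twinSet-unique : ∀ l → Unique (twinSet l)
twinSet-unique zero    = ((λ ()) ∷ []) ∷ [] ∷ []
twinSet-unique (suc k) = extend-unique (extend-unique (twinSet-unique k))

∈-extend : ∀ {n} b {v : Vec Bool n} {D} → v ∈ D → b ∷ v ∈ extend D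
∈-extend b v∈ = ∈-cartesianProductWith⁺ _∷_ (∈-bits b) v∈

∈-twinSet : ∀ l x {p} → p ∈ twinCorners → place l x p ∈ twinSet l
∈-twinSet zero    []          p∈ = p∈
∈-twinSet (suc k) (a ∷ b ∷ x) p∈ = ∈-extend a (∈-extend b (∈-twinSet k x p∈))

twinSet-corner : ∀ l {v} → v ∈ twinSet l → corner l v ∈ twinCorners
twinSet-corner zero    v∈ = v∈
twinSet-corner (suc k) v∈
  with _ , _ , _ , w∈ , refl ← ∈-cartesianProductWith⁻ _∷_ bits (extend (twinSet k)) v∈
  with _ , _ , _ , u∈ , refl ← ∈-cartesianProductWith⁻ _∷_ bits (twinSet k) w∈
  = twinSet-corner k u∈

-- The corners 01 and 10 are each adjacent to both twins of their cell. Domination uses one of these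
-- neighbours, 2-domination both.
twinOrBetween : ∀ l v → v ∈ twinSet l ⊎
  (∃[ x ] Adjacent l v (place l x (𝟎 ∷ 𝟎 ∷ [])) × Adjacent l v (place l x (𝟏 ∷ 𝟏 ∷ [])))
twinOrBetween l v with placed l v
... | x , eq with corner l v
...   | 𝟎 ∷ 𝟎 ∷ [] rewrite eq = inj₁ (∈-twinSet l x (here refl))
...   | 𝟏 ∷ 𝟏 ∷ [] rewrite eq = inj₁ (∈-twinSet l x (there (here refl)))
...   | 𝟎 ∷ 𝟏 ∷ [] rewrite eq =
  inj₂ (x , place-adjacent l x (bwd 00–01) , place-adjacent l x (fwd 01–11))
...   | 𝟏 ∷ 𝟎 ∷ [] rewrite eq =
  inj₂ (x , place-adjacent l x (fwd 10–00) , place-adjacent l x (bwd 11–10))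

twinSet-dominating : ∀ l → Dominating (FCN l) (twinSet l)
twinSet-dominating l v with twinOrBetween l v
... | inj₁ v∈ = inj₁ v∈
... | inj₂ (x , e , _) = inj₂ (_ , ∈-twinSet l x (here refl) , e)

twinSet-twoDominating : ∀ l → TwoDominating (FCN l) (twinSet l)
twinSet-twoDominating l v v∉ with twinOrBetween l v
... | inj₁ v∈ = contradiction v∈ v∉
... | inj₂ (x , e , e′) = _ , _ , (λ eq → contradiction (place-injective l x eq) λ ()) ,
  (∈-twinSet l x (here refl) , e) , (∈-twinSet l x (there (here refl)) , e′)

-- Resolving by the twins

twinSet-near : ∀ l v → ∃[ s ] s ∈ twinSet l × dist l v s ≤ 1
twinSet-near l v with twinSet-dominating l v
... | inj₁ v∈ = v , v∈ , ≤-trans (≤-reflexive (dist-refl l v)) z≤n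
... | inj₂ (s , s∈ , e) = s , s∈ , dist-minimal l (step e nil)

link-far : ∀ k {s} → s ∈ twinSet k → 1 ≤ dist k (link k) s
link-far k s∈ = n≢0⇒n>0 (dist≢0 k λ { refl → link-corner k (twinSet-corner k s∈) })

join-far : ∀ h s p {q} → h ≢ 0 → 1 ≤ q → 2 ≤ join h s p q
join-far zero    s p     h≢0 1≤q = contradiction refl h≢0
join-far (suc h) s p {q} h≢0 1≤q =
  ≤-trans (s≤s (≤-trans 1≤q (m≤n+m q h))) (m≤n+m (suc h + q) p)

-- Seen from another copy, two vertices of one copy differ in distance exactly as they do seen from
-- their own link.
join-cancel : ∀ h {s s′ p p′} q → h ≢ 0 → join h s p q ≡ join h s′ p′ q → p ≡ p′
join-cancel zero    q h≢0 eq = contradiction refl h≢0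
join-cancel (suc h) q h≢0 eq = +-cancelʳ-≡ (suc h + q) _ _ eq

-- Two adjacent vertices resolve a 4-cycle. Of these, 00 is a twin, and 10 is `link 0`, whose
-- distances can be read off from a neighbouring copy.
square-resolved : ∀ u v → u ≢ v →
  squareDist u (𝟎 ∷ 𝟎 ∷ []) ≢ squareDist v (𝟎 ∷ 𝟎 ∷ []) ⊎
  squareDist u (𝟏 ∷ 𝟎 ∷ []) ≢ squareDist v (𝟏 ∷ 𝟎 ∷ [])
square-resolved (𝟎 ∷ 𝟎 ∷ []) (𝟎 ∷ 𝟎 ∷ []) u≢v = contradiction refl u≢v
square-resolved (𝟎 ∷ 𝟎 ∷ []) (𝟎 ∷ 𝟏 ∷ []) _ = inj₁ λ ()
square-resolved (𝟎 ∷ 𝟎 ∷ []) (𝟏 ∷ 𝟎 ∷ []) _ = inj₁ λ ()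
square-resolved (𝟎 ∷ 𝟎 ∷ []) (𝟏 ∷ 𝟏 ∷ []) _ = inj₁ λ ()
square-resolved (𝟎 ∷ 𝟏 ∷ []) (𝟎 ∷ 𝟎 ∷ []) _ = inj₁ λ ()
square-resolved (𝟎 ∷ 𝟏 ∷ []) (𝟎 ∷ 𝟏 ∷ []) u≢v = contradiction refl u≢v
square-resolved (𝟎 ∷ 𝟏 ∷ []) (𝟏 ∷ 𝟎 ∷ []) _ = inj₂ λ ()
square-resolved (𝟎 ∷ 𝟏 ∷ []) (𝟏 ∷ 𝟏 ∷ []) _ = inj₁ λ ()
square-resolved (𝟏 ∷ 𝟎 ∷ []) (𝟎 ∷ 𝟎 ∷ []) _ = inj₁ λ ()
square-resolved (𝟏 ∷ 𝟎 ∷ []) (𝟎 ∷ 𝟏 ∷ []) _ = inj₂ λ ()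
square-resolved (𝟏 ∷ 𝟎 ∷ []) (𝟏 ∷ 𝟎 ∷ []) u≢v = contradiction refl u≢v
square-resolved (𝟏 ∷ 𝟎 ∷ []) (𝟏 ∷ 𝟏 ∷ []) _ = inj₁ λ ()
square-resolved (𝟏 ∷ 𝟏 ∷ []) (𝟎 ∷ 𝟎 ∷ []) _ = inj₁ λ ()
square-resolved (𝟏 ∷ 𝟏 ∷ []) (𝟎 ∷ 𝟏 ∷ []) _ = inj₁ λ ()
square-resolved (𝟏 ∷ 𝟏 ∷ []) (𝟏 ∷ 𝟎 ∷ []) _ = inj₁ λ ()
square-resolved (𝟏 ∷ 𝟏 ∷ []) (𝟏 ∷ 𝟏 ∷ []) u≢v = contradiction refl u≢v

Separated : ∀ l → String l → String l → Set
Separated l g h = ∃[ r ] r ∈ twinSet l × dist l g r ≢ dist l h r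

separated-sameCopy : ∀ k a b {u v} → Separated k u v → Separated (suc k) (a ∷ b ∷ u) (a ∷ b ∷ v)
separated-sameCopy k a b (r , r∈ , d≢) = a ∷ b ∷ r , ∈-extend a (∈-extend b r∈) , d≢′
  where
  d≢′ : dist (suc k) (a ∷ b ∷ _) (a ∷ b ∷ r) ≢ dist (suc k) (a ∷ b ∷ _) (a ∷ b ∷ r)
  d≢′ rewrite squareDist-refl (a ∷ b ∷ []) = d≢

separated : ∀ k g h → g ≢ h → Separated (suc k) g h
separated k (a ∷ b ∷ u) (c ∷ d ∷ v) g≢h with ≡-dec _≟ᵇ_ (a ∷ b ∷ []) (c ∷ d ∷ [])
separated zero (a ∷ b ∷ u) (a ∷ b ∷ v) g≢h | yes refl
  with square-resolved u v (λ { refl → g≢h refl })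
... | inj₁ d≢ = separated-sameCopy 0 a b (𝟎 ∷ 𝟎 ∷ [] , here refl , d≢)
... | inj₂ d≢ =
  -- The twin 00 of an adjacent copy stands in for 10. The constant 1 in `join-cancel` is its
  -- distance to the link of its own copy.
  not a ∷ b ∷ 𝟎 ∷ 𝟎 ∷ [] ,
  ∈-extend (not a) (∈-extend b {D = twinCorners} (here refl)) ,
  λ eq → d≢ (join-cancel (squareDist (a ∷ b ∷ []) (not a ∷ b ∷ [])) 1 (hop a) eq)
  where
  hop : ∀ a → bitDist a (not a) + bitDist b b ≢ 0
  hop 𝟎 ()
  hop 𝟏 ()
separated (suc k) (a ∷ b ∷ u) (a ∷ b ∷ v) g≢h | yes refl =
  separated-sameCopy (suc k) a b (separated k u v λ { refl → g≢h refl })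
separated k (a ∷ b ∷ u) (c ∷ d ∷ v) g≢h | no ab≢cd with twinSet-near k u
-- The vertex `s` lies within distance 1 of `u`. From the other copy, reaching it takes at least one
-- link edge and, since a twin is never a link, at least one more edge.
... | s , s∈ , near = a ∷ b ∷ s , ∈-extend a (∈-extend b s∈) , λ eq →
  contradiction (≤-trans (subst (2 ≤_) (sym eq) far) near′) λ { (s≤s ()) }
  where
  far : 2 ≤ dist (suc k) (c ∷ d ∷ v) (a ∷ b ∷ s)
  far = join-far _ (dist k v s) (dist k v (link k)) (dist≢0 0 (ab≢cd ∘ sym)) (link-far k s∈)

  near′ : dist (suc k) (a ∷ b ∷ u) (a ∷ b ∷ s) ≤ 1
  near′ rewrite squareDist-refl (a ∷ b ∷ []) = near

twinSet-resolving : ∀ k → Resolving (FCN (suc k)) (twinSet (suc k))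
twinSet-resolving k g h g≢h with r , r∈ , d≢ ← separated k g h g≢h = r , r∈ , resolves (suc k) d≢

-- The two domination numbers

resolvingDominationNumber : ∀ k → IsResolvingDominationNumber (FCN (suc k)) (size (suc k))
resolvingDominationNumber k =
  ( twinSet (suc k) , twinSet-unique (suc k)
  , (twinSet-resolving k , twinSet-dominating (suc k)) , length-twinSet (suc k) ) ,
  λ _ _ rd → twoPerCell-size (suc k) (resolvingDominating⇒twoPerCell (suc k) rd)

2-dominationNumber : ∀ l → Is2DominationNumber (FCN l) (size l)
2-dominationNumber l =
  (twinSet l , twinSet-unique l , twinSet-twoDominating l , length-twinSet l) ,
  λ _ _ td → twoPerCell-size l (twoDominating⇒twoPerCell l td)

theorem27 : ∀ (l : ℕ) → l ≥ 1 →
    ∃[ γᵣ ] ∃[ γ₂ ]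
    IsResolvingDominationNumber (FCN l) γᵣ
    × Is2DominationNumber (FCN (l ∸ 1)) γ₂
    × γᵣ ≡ 4 * γ₂
theorem27 (suc k) _ =
  -- By definition `size (suc k)` is `4 * size k`, hence `refl`.
  size (suc k) , size k , resolvingDominationNumber k , 2-dominationNumber k , refl
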